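{- Let $G$ be a connected graph and let $H$ be a graph (not necessarily connected) that is not complete. Then $$\dim_{n\ell}(G\odot H)=n(G)\cdot \dim_{n\ell}(H+K_1).$$
   Context: Graphs are finite and simple; $d(u,v)$ is the shortest-path distance and $n(G)$ the number of vertices. A set $X\subseteq V(G)$ resolves two vertices $u,v$ if some $x\in X$ satisfies $d(u,x)\neq d(v,x)$. $X$ is a nonlocal resolving set of a connected graph if it resolves every pair of distinct non-adjacent vertices; the nonlocal metric dimension $\dim_{n\ell}$ is the minimum size of a nonlocal resolving set. The join $G+H$ is obtained from disjoint copies of $G$ and $H$ by adding all edges between them. For $V(G)=\{g_1,\dots,g_{n(G)}\}$, the corona product $G\odot H$ is obtained from the disjoint union of $G$ and $n(G)$ copies $H_1,\dots,H_{n(G)}$ of $H$ by joining $g_i$ to every vertex of $H_i$ for each $i$. -}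

module Defs where

open import Data.Empty using (⊥-elim)
open import Data.Fin using (Fin; zero)
import Data.Fin.Properties as Fin
open import Data.Fin.Subset using (Subset; _∈_; ∣_∣; ⊤)
open import Data.Fin.Subset.Properties using (_∈?_; ∈⊤; anySubset?)
open import Data.Nat using (ℕ; zero; suc; _+_; _*_; _≤_; z≤n; s≤s)
import Data.Nat.Properties as ℕ
open import Data.Product using (∃; Σ; _×_; _,_; proj₁; proj₂)
open import Data.Product.Function.NonDependent.Propositional using (_×-↔_)
open import Data.Sum using (_⊎_; inj₁; inj₂)
open import Data.Sum.Function.Propositional using (_⊎-↔_)
open import Data.Unit using (tt) renaming (⊤ to Unit)
open import Function using (_∘_)
open import Function.Bundles using (_↔_; Inverse)
open import Function.Construct.Identity using (↔-id)
open import Function.Properties.Inverse using (↔-sym; ↔-trans; ↔⇒↣)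
open import Relation.Binary.Definitions using (Decidable; DecidableEquality; Symmetric)
open import Relation.Binary.PropositionalEquality using (_≡_; _≢_; refl; sym; trans; subst)
open import Relation.Nullary using (¬_; Dec; yes; no)
open import Relation.Nullary.Decidable using (map′; via-injection; ¬?; _×-dec_; _→-dec_)

Least : (ℕ → Set) → Set
Least P = Σ ℕ λ m → P m × (∀ j → P j → m ≤ j)

leastBelow : {P : ℕ → Set} → (∀ k → Dec (P k)) → ∀ k → P k → Least P
leastBelow P? zero    p = zero , p , λ _ _ → z≤n
leastBelow P? (suc k) p with P? zero
... | yes p₀ = zero , p₀ , λ _ _ → z≤n
... | no ¬p₀ with leastBelow (P? ∘ suc) k p
...   | m , pm , min = suc m , pm ,
        λ { zero p₀ → ⊥-elim (¬p₀ p₀) ; (suc j) pj → s≤s (min j pj) }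

least : {P : ℕ → Set} → (∀ k → Dec (P k)) → ∃ P → Least P
least P? (k , p) = leastBelow P? k p

-- Finite simple graphs.  Decidability of adjacency is automatic classically.
record Graph : Set₁ where
  field
    order  : ℕ
    V      : Set
    enum   : V ↔ Fin order
    Adj    : V → V → Set
    adj?   : Decidable Adj
    symm   : Symmetric Adj
    irrefl : ∀ {v} → ¬ Adj v v

  index : V → Fin order
  index = Inverse.to enum

  vertex : Fin order → V
  vertex = Inverse.from enum

  vertex-index : ∀ v → vertex (index v) ≡ v
  vertex-index = Inverse.strictlyInverseʳ enum

  _≟_ : DecidableEquality V
  _≟_ = via-injection (↔⇒↣ enum) Fin._≟_

  all? : {P : V → Set} → (∀ v → Dec (P v)) → Dec (∀ v → P v)
  all? {P} P? = map′ (λ f v → subst P (vertex-index v) (f (index v)))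
                     (λ f i → f (vertex i))
                     (Fin.all? (P? ∘ vertex))

  any? : {P : V → Set} → (∀ v → Dec (P v)) → Dec (∃ P)
  any? {P} P? = map′ (λ (i , p) → vertex i , p)
                     (λ (v , p) → index v , subst P (sym (vertex-index v)) p)
                     (Fin.any? (P? ∘ vertex))

  Complete : Set
  Complete = ∀ u v → u ≢ v → Adj u v

  data Walk : V → V → ℕ → Set where
    []  : ∀ {u} → Walk u u 0
    _∷_ : ∀ {u v w k} → Adj u v → Walk v w k → Walk u w (suc k)

  walk? : ∀ u v k → Dec (Walk u v k)
  walk? u v zero    = map′ (λ { refl → [] }) (λ { [] → refl }) (u ≟ v)
  walk? u v (suc k) = map′ (λ (_ , a , p) → a ∷ p) (λ { (a ∷ p) → _ , a , p })
                           (any? λ w → adj? u w ×-dec walk? w v k)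

  Connected : Set
  Connected = ∀ u v → ∃ (Walk u v)

  -- Vertex sets are subsets of Fin order, read through the enumeration.
  VertexSet : Set
  VertexSet = Subset order

  _∈ᵛ_ : V → VertexSet → Set
  v ∈ᵛ X = index v ∈ X

  module Metric (connected : Connected) where

    shortestWalk : ∀ u v → Least (Walk u v)
    shortestWalk u v = least (walk? u v) (connected u v)

    d : V → V → ℕ
    d u v = proj₁ (shortestWalk u v)

    Resolves : VertexSet → V → V → Set
    Resolves X u v = ∃ λ x → x ∈ᵛ X × d u x ≢ d v x

    NonlocalResolving : VertexSet → Set
    NonlocalResolving X = ∀ u v → u ≢ v → ¬ Adj u v → Resolves X u v

    nonlocalResolving? : ∀ X → Dec (NonlocalResolving X)
    nonlocalResolving? X =
      all? λ u → all? λ v → ¬? (u ≟ v) →-dec (¬? (adj? u v) →-dec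
        any? λ x → (index x ∈? X) ×-dec ¬? (d u x ℕ.≟ d v x))

    HasNonlocalResolvingSetOfSize : ℕ → Set
    HasNonlocalResolvingSetOfSize k = ∃ λ X → NonlocalResolving X × ∣ X ∣ ≡ k

    d-refl : ∀ u → d u u ≡ 0
    d-refl u = ℕ.n≤0⇒n≡0 (proj₂ (proj₂ (shortestWalk u u)) 0 [])

    d≡0⇒≡ : ∀ u v → d u v ≡ 0 → u ≡ v
    d≡0⇒≡ u v eq with subst (Walk u v) eq (proj₁ (proj₂ (shortestWalk u v)))
    ... | [] = refl

    ⊤-nonlocalResolving : NonlocalResolving ⊤
    ⊤-nonlocalResolving u v u≢v _ =
      u , ∈⊤ , λ eq → u≢v (sym (d≡0⇒≡ v u (trans (sym eq) (d-refl u))))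

    minimumNonlocalResolvingSet : Least HasNonlocalResolvingSetOfSize
    minimumNonlocalResolvingSet =
      least (λ k → anySubset? λ X → nonlocalResolving? X ×-dec (∣ X ∣ ℕ.≟ k))
            (∣ ⊤ {order} ∣ , ⊤ , ⊤-nonlocalResolving , refl)

    nonlocalDim : ℕ
    nonlocalDim = proj₁ minimumNonlocalResolvingSet

open Graph

dimₙₗ : (G : Graph) → Connected G → ℕ
dimₙₗ G c = Metric.nonlocalDim G c

K : ℕ → Graph
K n = record
  { order  = n
  ; V      = Fin n
  ; enum   = ↔-id (Fin n)
  ; Adj    = _≢_
  ; adj?   = λ i j → ¬? (i Fin.≟ j)
  ; symm   = λ i≢j → i≢j ∘ sym
  ; irrefl = λ i≢i → i≢i refl
  }

module Join (G H : Graph) where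

  JoinAdj : V G ⊎ V H → V G ⊎ V H → Set
  JoinAdj (inj₁ g) (inj₁ g′) = Adj G g g′
  JoinAdj (inj₁ _) (inj₂ _)  = Unit
  JoinAdj (inj₂ _) (inj₁ _)  = Unit
  JoinAdj (inj₂ h) (inj₂ h′) = Adj H h h′

  joinAdj? : Decidable JoinAdj
  joinAdj? (inj₁ g) (inj₁ g′) = adj? G g g′
  joinAdj? (inj₁ _) (inj₂ _)  = yes tt
  joinAdj? (inj₂ _) (inj₁ _)  = yes tt
  joinAdj? (inj₂ h) (inj₂ h′) = adj? H h h′

  joinSymm : Symmetric JoinAdj
  joinSymm {inj₁ _} {inj₁ _} a = symm G a
  joinSymm {inj₁ _} {inj₂ _} _ = tt
  joinSymm {inj₂ _} {inj₁ _} _ = tt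
  joinSymm {inj₂ _} {inj₂ _} a = symm H a

  joinIrrefl : ∀ {v} → ¬ JoinAdj v v
  joinIrrefl {inj₁ _} = irrefl G
  joinIrrefl {inj₂ _} = irrefl H

infixl 6 _+ᴳ_
_+ᴳ_ : Graph → Graph → Graph
G +ᴳ H = record
  { order  = order G + order H
  ; V      = V G ⊎ V H
  ; enum   = ↔-trans (enum G ⊎-↔ enum H) (↔-sym Fin.+↔⊎)
  ; Adj    = JoinAdj
  ; adj?   = joinAdj?
  ; symm   = λ {u} {v} → joinSymm {u} {v}
  ; irrefl = λ {v} → joinIrrefl {v}
  }
  where open Join G H

-- inj₁ g is the vertex g of G; inj₂ (g , h) is the vertex h in the copy of H
-- attached to g.
module Corona (G H : Graph) where

  CoronaV : Set
  CoronaV = V G ⊎ (V G × V H)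

  CoronaAdj : CoronaV → CoronaV → Set
  CoronaAdj (inj₁ g)       (inj₁ g′)        = Adj G g g′
  CoronaAdj (inj₁ g)       (inj₂ (g′ , _))  = g ≡ g′
  CoronaAdj (inj₂ (g , _)) (inj₁ g′)        = g ≡ g′
  CoronaAdj (inj₂ (g , h)) (inj₂ (g′ , h′)) = g ≡ g′ × Adj H h h′

  coronaAdj? : Decidable CoronaAdj
  coronaAdj? (inj₁ g)       (inj₁ g′)        = adj? G g g′
  coronaAdj? (inj₁ g)       (inj₂ (g′ , _))  = _≟_ G g g′
  coronaAdj? (inj₂ (g , _)) (inj₁ g′)        = _≟_ G g g′
  coronaAdj? (inj₂ (g , h)) (inj₂ (g′ , h′)) = _≟_ G g g′ ×-dec adj? H h h′

  coronaSymm : Symmetric CoronaAdj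
  coronaSymm {inj₁ _} {inj₁ _} a        = symm G a
  coronaSymm {inj₁ _} {inj₂ _} eq       = sym eq
  coronaSymm {inj₂ _} {inj₁ _} eq       = sym eq
  coronaSymm {inj₂ _} {inj₂ _} (eq , a) = sym eq , symm H a

  coronaIrrefl : ∀ {v} → ¬ CoronaAdj v v
  coronaIrrefl {inj₁ _}       = irrefl G
  coronaIrrefl {inj₂ _} (_ , a) = irrefl H a

infixl 7 _⊙_
_⊙_ : Graph → Graph → Graph
G ⊙ H = record
  { order  = order G + order G * order H
  ; V      = CoronaV
  ; enum   = ↔-trans (enum G ⊎-↔ ↔-trans (enum G ×-↔ enum H) (↔-sym Fin.*↔×))
                     (↔-sym Fin.+↔⊎)
  ; Adj    = CoronaAdj
  ; adj?   = coronaAdj?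
  ; symm   = λ {u} {v} → coronaSymm {u} {v}
  ; irrefl = λ {v} → coronaIrrefl {v}
  }
  where open Corona G H

+K₁-connected : (H : Graph) → Connected (H +ᴳ K 1)
+K₁-connected H (inj₁ _) (inj₁ _) = 2 , _∷_ {v = inj₂ zero} tt (tt ∷ [])
+K₁-connected H (inj₁ _) (inj₂ _) = 1 , tt ∷ []
+K₁-connected H (inj₂ _) (inj₁ _) = 1 , tt ∷ []
+K₁-connected H (inj₂ zero) (inj₂ zero) = 0 , []

module _ (G H : Graph) where

  walk-inj₁ : ∀ {g g′ k} → Walk G g g′ k → Walk (G ⊙ H) (inj₁ g) (inj₁ g′) k
  walk-inj₁ []      = []
  walk-inj₁ (a ∷ p) = a ∷ walk-inj₁ p

  walk-snoc : ∀ {u v w k} → Walk (G ⊙ H) u v k → Adj (G ⊙ H) v w →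
              Walk (G ⊙ H) u w (suc k)
  walk-snoc []      b = b ∷ []
  walk-snoc (a ∷ p) b = a ∷ walk-snoc p b

  ⊙-connected : Connected G → Connected (G ⊙ H)
  ⊙-connected c (inj₁ g) (inj₁ g′) = _ , walk-inj₁ (proj₂ (c g g′))
  ⊙-connected c (inj₁ g) (inj₂ (g′ , _)) =
    _ , walk-snoc (walk-inj₁ (proj₂ (c g g′))) refl
  ⊙-connected c (inj₂ (g , _)) (inj₁ g′) =
    _ , _∷_ {v = inj₁ g} refl (walk-inj₁ (proj₂ (c g g′)))
  ⊙-connected c (inj₂ (g , _)) (inj₂ (g′ , _)) =
    _ , _∷_ {v = inj₁ g} refl (walk-snoc (walk-inj₁ (proj₂ (c g g′))) refl)

{-# OPTIONS --safe #-}
-- A vertex outside the copy of H at g is equally far from all vertices of that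
-- copy, since every path leaving the copy goes through g.  So only vertices of
-- the copy itself resolve its non-adjacent pairs, and they do so exactly as in
-- H + K₁, where all distances are at most 2 and the apex resolves nothing.
-- Hence a nonlocal resolving set of G ⊙ H meets every copy in at least
-- dimₙₗ (H + K₁) vertices.  Conversely, take in every copy the same minimum
-- nonlocal resolving set of H + K₁, restricted to H.  It is nonempty because H
-- is not complete, so some s of it lies in the copy at g, and s separates the
-- vertices at g (the vertex g and its copy of H) from those at any g′ ≠ g.
module Submission where

open import Defs
open import Data.Bool using (true; false)
open import Data.Fin using (zero; suc; combine)
open import Data.Fin.Subset using (Subset; _∈_; ∣_∣; ⊥)
open import Data.Fin.Subset.Properties using (nonempty?; ∣⊥∣≡0)
open import Data.Nat using (ℕ; suc; _+_; _*_; _≤_; z≤n; s≤s)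
import Data.Nat.Properties as ℕ
open import Data.Product using (∃; _×_; _,_; proj₁; proj₂)
open import Data.Sum using (inj₁; inj₂)
open import Data.Unit using (tt)
open import Data.Vec using (Vec; []; _∷_; _++_; concat; group; lookup; replicate; splitAt)
open import Data.Vec.Properties using ([]=⇒lookup; lookup⇒[]=; lookup-++ˡ; lookup-++ʳ; lookup-concat; lookup-replicate)
open import Function using (_∘_)
open import Function.Bundles using (Inverse)
open import Relation.Binary.PropositionalEquality using (_≡_; _≢_; refl; sym; trans; cong; cong₂; subst)
open import Relation.Nullary using (¬_; yes; no; contradiction)
open Graph using (order; Connected; Complete)
open Graph hiding (order; Connected; Complete)

∣++∣ : ∀ {m n} (p : Subset m) (q : Subset n) → ∣ p ++ q ∣ ≡ ∣ p ∣ + ∣ q ∣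
∣++∣ []          q = refl
∣++∣ (true ∷ p)  q = cong suc (∣++∣ p q)
∣++∣ (false ∷ p) q = ∣++∣ p q

∣concat-replicate∣ : ∀ {m} n (p : Subset m) → ∣ concat (replicate n p) ∣ ≡ n * ∣ p ∣
∣concat-replicate∣ ℕ.zero  p = refl
∣concat-replicate∣ (suc n) p =
  trans (∣++∣ p _) (cong (∣ p ∣ +_) (∣concat-replicate∣ n p))

∣concat∣-≥ : ∀ {m n k} (ps : Vec (Subset m) n) → (∀ i → k ≤ ∣ lookup ps i ∣) →
             n * k ≤ ∣ concat ps ∣
∣concat∣-≥ []       k≤ = z≤n
∣concat∣-≥ (p ∷ ps) k≤ = ℕ.≤-trans
  (ℕ.+-mono-≤ (k≤ zero) (∣concat∣-≥ ps (k≤ ∘ suc)))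
  (ℕ.≤-reflexive (sym (∣++∣ p _)))

-- Phrased through `lookup` so that the index laws of `++` and `concat` move membership between
-- subsets of different sizes.
∈-transport : ∀ {m n} {p : Subset m} {q : Subset n} {i j} →
              lookup p i ≡ lookup q j → i ∈ p → j ∈ q
∈-transport {q = q} {j = j} eq i∈p = lookup⇒[]= j q (trans (sym eq) ([]=⇒lookup i∈p))

module _ (Γ : Graph) (c : Connected Γ) where
  open Metric Γ c

  d-≤ : ∀ u v {k} → Walk Γ u v k → d u v ≤ k
  d-≤ u v p = proj₂ (proj₂ (shortestWalk u v)) _ p

  ≤-d : ∀ u v {m} → (∀ k → Walk Γ u v k → m ≤ k) → m ≤ d u v
  ≤-d u v h = h _ (proj₁ (proj₂ (shortestWalk u v)))

  2≤d : ∀ u v → u ≢ v → ¬ Adj Γ u v → 2 ≤ d u v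
  2≤d u v u≢v ¬a = ≤-d u v λ
    { _ []          → contradiction refl u≢v
    ; _ (a ∷ [])    → contradiction a ¬a
    ; _ (_ ∷ _ ∷ _) → s≤s (s≤s z≤n) }

  nonlocalDim-≤ : ∀ X → NonlocalResolving X → nonlocalDim ≤ ∣ X ∣
  nonlocalDim-≤ X r = proj₂ (proj₂ minimumNonlocalResolvingSet) _ (X , r , refl)

-- Two vertices with a common neighbour are at distance 0, 1 or 2 according to
-- equality and adjacency alone, so such distances compare across graphs.
d-≤-d : ∀ (Γ : Graph) (c : Connected Γ) (Γ′ : Graph) (c′ : Connected Γ′) u v u′ v′ →
        (u ≡ v → u′ ≡ v′) → (Adj Γ u v → Adj Γ′ u′ v′) → Walk Γ′ u′ v′ 2 →
        Metric.d Γ′ c′ u′ v′ ≤ Metric.d Γ c u v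
d-≤-d Γ c Γ′ c′ u v u′ v′ eq adj p = ≤-d Γ c u v λ
  { _ []          → d-≤ Γ′ c′ u′ v′ (subst (λ v → Walk Γ′ u′ v 0) (eq refl) [])
  ; _ (a ∷ [])    → d-≤ Γ′ c′ u′ v′ (adj a ∷ [])
  ; _ (_ ∷ _ ∷ _) → ℕ.≤-trans (d-≤ Γ′ c′ u′ v′ p) (s≤s (s≤s z≤n)) }

module _ (H : Graph) where

  private
    J = H +ᴳ K 1
    J-connected = +K₁-connected H
    module J = Metric J J-connected

  -- The apex caps this at 2: it is 0, 1 or 2 for equal, adjacent or other pairs, even when `H` is
  -- disconnected.
  δ : V H → V H → ℕ
  δ h h′ = J.d (inj₁ h) (inj₁ h′)

  -- The condition that `H + K₁` imposes on the `H`-part of a vertex set, stated without the apex so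
  -- that it can be asked of each copy of `H`.
  ApexResolving : VertexSet H → Set
  ApexResolving S = ∀ u v → u ≢ v → ¬ Adj H u v → ∃ λ x → index H x ∈ S × δ u x ≢ δ v x

  d-apex : ∀ h i → J.d (inj₁ h) (inj₂ i) ≡ 1
  d-apex h i = ℕ.≤-antisym (d-≤ J J-connected (inj₁ h) (inj₂ i) (tt ∷ []))
                           (≤-d J J-connected (inj₁ h) (inj₂ i) λ { _ (_ ∷ _) → s≤s z≤n })

  nonlocalResolving⇒apexResolving : ∀ S T → J.NonlocalResolving (S ++ T) → ApexResolving S
  nonlocalResolving⇒apexResolving S T r u v u≢v ¬a
    with r (inj₁ u) (inj₁ v) (λ { refl → u≢v refl }) ¬a
  ... | inj₁ x , x∈ , ≢ = x , ∈-transport (lookup-++ˡ S T (index H x)) x∈ , ≢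
  ... | inj₂ i , _  , ≢ = contradiction (trans (d-apex u i) (sym (d-apex v i))) ≢

  -- The apex is adjacent to every other vertex, so each non-adjacent pair lies in `H`.
  apexResolving⇒nonlocalResolving : ∀ S T → ApexResolving S → J.NonlocalResolving (S ++ T)
  apexResolving⇒nonlocalResolving S T r (inj₁ u) (inj₁ v) u≢v ¬a
    with r u v (u≢v ∘ cong inj₁) ¬a
  ... | x , x∈ , ≢ = inj₁ x , ∈-transport (sym (lookup-++ˡ S T (index H x))) x∈ , ≢
  apexResolving⇒nonlocalResolving S T r (inj₁ _)    (inj₂ _)    _   ¬a = contradiction tt ¬a
  apexResolving⇒nonlocalResolving S T r (inj₂ _)    (inj₁ _)    _   ¬a = contradiction tt ¬a
  apexResolving⇒nonlocalResolving S T r (inj₂ zero) (inj₂ zero) u≢v _  = contradiction refl u≢v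

  nonlocalDim-≤-apexResolving : ∀ S → ApexResolving S → J.nonlocalDim ≤ ∣ S ∣
  nonlocalDim-≤-apexResolving S r = ℕ.≤-trans
    (nonlocalDim-≤ J J-connected (S ++ ⊥ {1}) (apexResolving⇒nonlocalResolving S (⊥ {1}) r))
    (ℕ.≤-reflexive (trans (∣++∣ S (⊥ {1})) (ℕ.+-identityʳ ∣ S ∣)))

  minimumApexResolving : ∃ λ S → ApexResolving S × ∣ S ∣ ≤ J.nonlocalDim
  minimumApexResolving with J.minimumNonlocalResolvingSet
  ... | _ , (X , r , refl) , _ with splitAt (order H) X
  ... | S , T , refl = S , nonlocalResolving⇒apexResolving S T r ,
        ℕ.≤-trans (ℕ.m≤m+n ∣ S ∣ ∣ T ∣) (ℕ.≤-reflexive (sym (∣++∣ S T)))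

  apexResolving-nonempty : ¬ Complete H → ∀ S → ApexResolving S → ∃ λ s → index H s ∈ S
  apexResolving-nonempty ¬complete S r with nonempty? S
  ... | yes (i , i∈S) =
        vertex H i , subst (_∈ S) (sym (Inverse.strictlyInverseˡ (enum H) i)) i∈S
  ... | no empty = contradiction complete ¬complete
    where
    complete : Complete H
    -- A non-adjacent pair would need a resolver in the empty `S`.
    complete u v u≢v with adj? H u v
    ... | yes a = a
    ... | no ¬a with r u v u≢v ¬a
    ...   | x , x∈S , _ = contradiction (index H x , x∈S) empty

module _ (G H : Graph) (c : Connected G) where

  private
    C = G ⊙ H
    C-connected = ⊙-connected G H c
    module C = Metric C C-connected

  walk-within-copy : ∀ {g h h′} → Walk C (inj₂ (g , h)) (inj₂ (g , h′)) 2
  walk-within-copy {g} = _∷_ {v = inj₁ g} refl (refl ∷ [])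

  -- The vertex `g` is a common neighbour just as the apex is, and both embeddings of `H` preserve
  -- and reflect equality and adjacency.
  d-within-copy : ∀ g h h′ → C.d (inj₂ (g , h)) (inj₂ (g , h′)) ≡ δ H h h′
  d-within-copy g h h′ = ℕ.≤-antisym
    (d-≤-d J (+K₁-connected H) C C-connected (inj₁ h) (inj₁ h′) (inj₂ (g , h)) (inj₂ (g , h′))
      (λ { refl → refl }) (refl ,_) walk-within-copy)
    (d-≤-d C C-connected J (+K₁-connected H) (inj₂ (g , h)) (inj₂ (g , h′)) (inj₁ h) (inj₁ h′)
      (λ { refl → refl }) proj₂ (_∷_ {v = inj₂ zero} tt (tt ∷ [])))
    where J = H +ᴳ K 1

  InCopy : V G → V C → Set
  InCopy g x = ∃ λ h → x ≡ inj₂ (g , h)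

  -- Induction on the walk: a step to `g` leaves a walk from `g` to `x`, and a step inside the copy
  -- only adds length.
  walk-leaving-copy : ∀ {g h x k} → ¬ InCopy g x → Walk C (inj₂ (g , h)) x k →
                      suc (C.d (inj₁ g) x) ≤ k
  walk-leaving-copy x∉ [] = contradiction (_ , refl) x∉
  walk-leaving-copy x∉ (_∷_ {v = inj₁ _} refl p) = s≤s (d-≤ C C-connected _ _ p)
  walk-leaving-copy x∉ (_∷_ {v = inj₂ _} (refl , _) p) = ℕ.m≤n⇒m≤1+n (walk-leaving-copy x∉ p)

  d-leaving-copy : ∀ g x h → ¬ InCopy g x → C.d (inj₂ (g , h)) x ≡ suc (C.d (inj₁ g) x)
  d-leaving-copy g x h x∉ = ℕ.≤-antisym
    (d-≤ C C-connected (inj₂ (g , h)) x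
      (_∷_ {v = inj₁ g} refl (proj₁ (proj₂ (C.shortestWalk (inj₁ g) x)))))
    (≤-d C C-connected (inj₂ (g , h)) x λ _ → walk-leaving-copy x∉)

  -- The enumeration lists `G` first and then the copies one after another, so `Y` is the part in
  -- `G` and `Ss` lists the traces on the copies.
  lookup-copy : ∀ (Y : VertexSet G) (Ss : Vec (VertexSet H) (order G)) g h →
                lookup (Y ++ concat Ss) (index C (inj₂ (g , h))) ≡
                lookup (lookup Ss (index G g)) (index H h)
  lookup-copy Y Ss g h = trans
    (lookup-++ʳ Y (concat Ss) (combine (index G g) (index H h)))
    (lookup-concat Ss (index G g) (index H h))

  nonlocalResolving⇒copyResolving : ∀ Y Ss → C.NonlocalResolving (Y ++ concat Ss) →
                                    ∀ g → ApexResolving H (lookup Ss (index G g))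
  nonlocalResolving⇒copyResolving Y Ss r g u v u≢v ¬a
    with r (inj₂ (g , u)) (inj₂ (g , v)) (λ { refl → u≢v refl }) (¬a ∘ proj₂)
  ... | inj₁ x , _ , ≢ = contradiction
        (trans (d-leaving-copy g (inj₁ x) u λ ()) (sym (d-leaving-copy g (inj₁ x) v λ ()))) ≢
  ... | inj₂ (g′ , x) , x∈ , ≢ with _≟_ G g g′
  ...   | yes refl = x , ∈-transport (lookup-copy Y Ss g x) x∈ , λ eq →
          ≢ (trans (d-within-copy g u x) (trans eq (sym (d-within-copy g v x))))
  ...   | no g≢g′ = contradiction
          (trans (d-leaving-copy g (inj₂ (g′ , x)) u outside)
                 (sym (d-leaving-copy g (inj₂ (g′ , x)) v outside))) ≢
    where
    outside : ¬ InCopy g (inj₂ (g′ , x))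
    outside (_ , refl) = g≢g′ refl

  module _ (S : VertexSet H) (r : ApexResolving H S) {s : V H} (s∈S : index H s ∈ S) where

    private
      X : VertexSet C
      X = ⊥ {order G} ++ concat (replicate (order G) S)

    copy∈ : ∀ g {x} → index H x ∈ S → index C (inj₂ (g , x)) ∈ X
    copy∈ g {x} = ∈-transport (sym (trans
      (lookup-copy ⊥ (replicate (order G) S) g x)
      (cong (λ p → lookup p (index H x)) (lookup-replicate (index G g) S))))

    separated : ∀ u v g k → C.d u (inj₂ (g , s)) ≤ k → suc k ≤ C.d v (inj₂ (g , s)) →
                C.d u (inj₂ (g , s)) ≢ C.d v (inj₂ (g , s))
    separated u v g k u≤ v> = ℕ.<⇒≢ (ℕ.≤-trans (s≤s u≤) v>)

    base-near : ∀ g → C.d (inj₁ g) (inj₂ (g , s)) ≤ 1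
    base-near g = d-≤ C C-connected (inj₁ g) (inj₂ (g , s)) (refl ∷ [])

    base-far : ∀ g g′ → g ≢ g′ → 2 ≤ C.d (inj₁ g′) (inj₂ (g , s))
    base-far g g′ g≢g′ = 2≤d C C-connected (inj₁ g′) (inj₂ (g , s)) (λ ()) (g≢g′ ∘ sym)

    copy-far : ∀ g g′ h → g ≢ g′ → 3 ≤ C.d (inj₂ (g′ , h)) (inj₂ (g , s))
    copy-far g g′ h g≢g′ = ℕ.≤-trans (s≤s (base-far g g′ g≢g′))
      (ℕ.≤-reflexive (sym (d-leaving-copy g′ (inj₂ (g , s)) h λ { (_ , refl) → g≢g′ refl })))

    apexResolving⇒nonlocalResolving-copies : C.NonlocalResolving X
    apexResolving⇒nonlocalResolving-copies (inj₁ g) (inj₁ g′) u≢v _ =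
      inj₂ (g , s) , copy∈ g s∈S ,
      separated (inj₁ g) (inj₁ g′) g 1 (base-near g) (base-far g g′ (u≢v ∘ cong inj₁))
    -- Here `¬a` says exactly that `g` and `g′` differ. The resolver is taken at the base vertex
    -- `g`: distance at most 1 against at least 3.
    apexResolving⇒nonlocalResolving-copies (inj₁ g) (inj₂ (g′ , h)) _ ¬a =
      inj₂ (g , s) , copy∈ g s∈S ,
      separated (inj₁ g) (inj₂ (g′ , h)) g 1 (base-near g) (ℕ.<⇒≤ (copy-far g g′ h ¬a))
    apexResolving⇒nonlocalResolving-copies (inj₂ (g′ , h)) (inj₁ g) _ ¬a =
      inj₂ (g , s) , copy∈ g s∈S ,
      separated (inj₁ g) (inj₂ (g′ , h)) g 1 (base-near g) (ℕ.<⇒≤ (copy-far g g′ h (¬a ∘ sym))) ∘ sym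
    apexResolving⇒nonlocalResolving-copies (inj₂ (g , h)) (inj₂ (g′ , h′)) u≢v ¬a
      with _≟_ G g g′
    -- The threshold is 2: any two vertices of one copy are joined through `g`, while different
    -- copies are at least 3 apart.
    ... | no g≢g′ = inj₂ (g , s) , copy∈ g s∈S ,
          separated (inj₂ (g , h)) (inj₂ (g′ , h′)) g 2
            (d-≤ C C-connected _ _ (walk-within-copy {g} {h} {s})) (copy-far g g′ h′ g≢g′)
    ... | yes refl with r h h′ (u≢v ∘ cong (λ z → inj₂ (g , z))) (¬a ∘ (refl ,_))
    ...   | x , x∈S , ≢ = inj₂ (g , x) , copy∈ g x∈S , λ eq →
            ≢ (trans (sym (d-within-copy g h x)) (trans eq (d-within-copy g h′ x)))

  dimₙₗ-⊙-≥ : order G * dimₙₗ (H +ᴳ K 1) (+K₁-connected H) ≤ C.nonlocalDim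
  dimₙₗ-⊙-≥ with C.minimumNonlocalResolvingSet
  ... | _ , (X , r , refl) , _ with splitAt (order G) X
  ... | Y , Z , refl with group (order G) (order H) Z
  ... | Ss , refl = ℕ.≤-trans
    (∣concat∣-≥ Ss λ i → nonlocalDim-≤-apexResolving H (lookup Ss i)
      -- Position `i` is read as the index of the vertex `vertex G i`.
      (subst (λ j → ApexResolving H (lookup Ss j)) (Inverse.strictlyInverseˡ (enum G) i)
        (nonlocalResolving⇒copyResolving Y Ss r (vertex G i))))
    -- Discarding the base vertices in `Y` only lowers the count.
    (ℕ.≤-trans (ℕ.m≤n+m _ ∣ Y ∣) (ℕ.≤-reflexive (sym (∣++∣ Y (concat Ss)))))

  dimₙₗ-⊙-≤ : ¬ Complete H →
              C.nonlocalDim ≤ order G * dimₙₗ (H +ᴳ K 1) (+K₁-connected H)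
  dimₙₗ-⊙-≤ ¬complete with minimumApexResolving H
  ... | S , r , ∣S∣≤ with apexResolving-nonempty H ¬complete S r
  ... | s , s∈S = begin
    C.nonlocalDim
      ≤⟨ nonlocalDim-≤ C C-connected _ (apexResolving⇒nonlocalResolving-copies S r s∈S) ⟩
    ∣ ⊥ {order G} ++ concat (replicate (order G) S) ∣
      ≡⟨ ∣++∣ (⊥ {order G}) _ ⟩
    ∣ ⊥ {order G} ∣ + ∣ concat (replicate (order G) S) ∣
      ≡⟨ cong₂ _+_ (∣⊥∣≡0 (order G)) (∣concat-replicate∣ (order G) S) ⟩
    order G * ∣ S ∣
      ≤⟨ ℕ.*-monoʳ-≤ (order G) ∣S∣≤ ⟩
    order G * dimₙₗ (H +ᴳ K 1) (+K₁-connected H) ∎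
    where open ℕ.≤-Reasoning

theorem3p2 : (G H : Graph) (G-connected : Connected G) → ¬ Complete H →
    dimₙₗ (G ⊙ H) (⊙-connected G H G-connected) ≡ order G * dimₙₗ (H +ᴳ K 1) (+K₁-connected H)
theorem3p2 G H G-connected ¬complete =
  ℕ.≤-antisym (dimₙₗ-⊙-≤ G H G-connected ¬complete) (dimₙₗ-⊙-≥ G H G-connected)
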